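{- Let $h:\{0,1,2,3\}^*\to\{0,1\}^*$ be the morphism defined by $$h(0)=00001101010,\quad h(1)=00011111010,\quad h(2)=00110100110,\quad h(3)=00111001010.$$ Then $h$ is $(3,3)$-abelian-square-free; that is, for every abelian-square-free word $w$ over $\{0,1,2,3\}$, the word $h(w)$ has no factor which is a $3$-abelian-square of period at least $3$.
   Context: For finite words $u,w$, $|u|_w$ denotes the number of occurrences of $w$ as a factor of $u$. For $k\ge 1$, two finite words $u,v$ are $k$-abelian equivalent if $|u|_w=|v|_w$ for every non-empty word $w$ with $|w|\le k$. A $k$-abelian-square is a non-empty word $u_1u_2$ with $u_1$ and $u_2$ $k$-abelian equivalent; its period is $|u_1|$. For $k=1$ one says simply abelian equivalent and abelian-square. A word is abelian-square-free if none of its factors is an abelian-square. A morphism $h$ is $(p,k)$-abelian-square-free if for every abelian-square-free word $w$, $h(w)$ avoids (contains no factor that is) $k$-abelian-squares of period at least $p$. -}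

module Defs where

open import Algebra.Morphism.Bundles using (MonoidHomomorphism)
open import Data.Fin using (Fin; _≟_)
open import Data.Fin.Patterns using (0F; 1F; 2F; 3F)
open import Data.List using (List; []; _∷_; _++_; length; filter; tails; concatMap; ++-[]-rawMonoid)
open import Data.List.Properties using (concatMap-++)
open import Data.List.Relation.Binary.Infix.Heterogeneous using (Infix)
open import Data.List.Relation.Binary.Prefix.Heterogeneous.Properties using (prefix?)
open import Data.Nat using (ℕ; _≤_; NonZero)
open import Level using (0ℓ)
open import Relation.Binary.PropositionalEquality using (_≡_; _≢_; refl; cong)
open import Relation.Nullary using (¬_)

private
  variable
    m n : ℕ

Word : ℕ → Set
Word n = List (Fin n)

Factor : Word n → Word n → Set
Factor = Infix _≡_

-- Each occurrence of w in u is a suffix of u that has w as a prefix.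
occurrences : Word n → Word n → ℕ
occurrences w u = length (filter (prefix? _≟_ w) (tails u))

AbelianEquivalent : (k : ℕ) → .{{NonZero k}} → Word n → Word n → Set
AbelianEquivalent {n} k u v =
  (w : Word n) → w ≢ [] → length w ≤ k → occurrences w u ≡ occurrences w v

record AbelianSquare (k : ℕ) .{{_ : NonZero k}} (x : Word n) : Set where
  field
    u₁ u₂      : Word n
    splits     : x ≡ u₁ ++ u₂
    nonEmpty   : x ≢ []
    equivalent : AbelianEquivalent k u₁ u₂

  period : ℕ
  period = length u₁

AbelianSquareFree : Word n → Set
AbelianSquareFree {n} w = (x : Word n) → Factor x w → ¬ AbelianSquare 1 x

AvoidsAbelianSquares : (p k : ℕ) → .{{NonZero k}} → Word n → Set
AvoidsAbelianSquares {n} p k w =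
  (x : Word n) → Factor x w → (s : AbelianSquare k x) → ¬ (p ≤ AbelianSquare.period s)

Morphism : ℕ → ℕ → Set
Morphism m n = MonoidHomomorphism (++-[]-rawMonoid (Fin m)) (++-[]-rawMonoid (Fin n))

AbelianSquareFreeMorphism : (p k : ℕ) → .{{NonZero k}} → Morphism m n → Set
AbelianSquareFreeMorphism {m} p k f =
  (w : Word m) → AbelianSquareFree w → AvoidsAbelianSquares p k (⟦ w ⟧)
  where open MonoidHomomorphism f

extend : (Fin m → Word n) → Morphism m n
extend f = record
  { ⟦_⟧ = concatMap f
  ; isMonoidHomomorphism = record
    { isMagmaHomomorphism = record
      { isRelHomomorphism = record { cong = cong (concatMap f) }
      ; homo              = concatMap-++ f
      }
    ; ε-homo = refl
    }
  }

hLetter : Fin 4 → Word 2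
hLetter 0F = 0F ∷ 0F ∷ 0F ∷ 0F ∷ 1F ∷ 1F ∷ 0F ∷ 1F ∷ 0F ∷ 1F ∷ 0F ∷ []
hLetter 1F = 0F ∷ 0F ∷ 0F ∷ 1F ∷ 1F ∷ 1F ∷ 1F ∷ 1F ∷ 0F ∷ 1F ∷ 0F ∷ []
hLetter 2F = 0F ∷ 0F ∷ 1F ∷ 1F ∷ 0F ∷ 1F ∷ 0F ∷ 0F ∷ 1F ∷ 1F ∷ 0F ∷ []
hLetter 3F = 0F ∷ 0F ∷ 1F ∷ 1F ∷ 1F ∷ 0F ∷ 0F ∷ 1F ∷ 0F ∷ 1F ∷ 0F ∷ []

h : Morphism 4 2
h = extend hLetter

{-# OPTIONS --safe #-}
module Submission where

-- Squares of period at most 11 lie in the image of three letters and are excluded by inspection.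
-- In a longer square u₁u₂ the three ends fall into the images of letters a, b, c of a factor
-- a x b y c of w. The images begin with 00 and end with 10, so a linear functional of the counts of
-- the factors of length 3 is additive over the letters of x and y, up to terms that depend only on
-- the positions of the cuts. Four functionals recover the letter counts, so the cuts determine the
-- difference of the Parikh vectors of x and y; a fifth one vanishes on all images and restricts the
-- cuts. For each of the finitely many remaining cuts, moving the ends by at most one letter turns
-- a x b y c into an abelian square of w.

open import Algebra.Properties.AbelianGroup using () renaming (∙-cancelʳ to group-cancelʳ)
open import Data.Bool using (true; false; if_then_else_; _∧_)
open import Data.Fin using (Fin; suc; toℕ; _≟_)
open import Data.Fin.Patterns using (0F; 1F; 2F; 3F)
open import Data.Fin.Properties using (all?; any?)
open import Data.Integer using (ℤ; +_; 0ℤ; _+_; _-_; _*_; -_)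
import Data.Integer.Properties as ℤ
open import Data.Integer.Divisibility.Signed using (_∣_; divides; _∣?_)
open import Data.Integer.Tactic.RingSolver using (solve-∀)
open import Data.List
  using (List; []; _∷_; _++_; _∷ʳ_; length; take; drop; map; concatMap; allFin; upTo;
         cartesianProductWith; initLast; _∷ʳ′_)
open import Data.List.Membership.Propositional using (_∈_)
open import Data.List.Membership.Propositional.Properties
  using (∈-allFin; ∈-upTo⁺; ∈-cartesianProductWith⁺)
open import Data.List.Properties
  using (∷-injective; ∷-injectiveˡ; ∷ʳ-injectiveʳ; ∷ʳ-++; ++-assoc; ++-identityʳ; ++-conicalˡ;
         ++-conicalʳ; ++-monoid; concatMap-++; length-++; length-++-≤ˡ; length-++-≤ʳ; take++drop≡id)
open import Data.List.Relation.Binary.Infix.Heterogeneous using (View; toView; fromView; MkView)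
open import Data.List.Relation.Binary.Pointwise using (Pointwise-≡⇒≡; ≡⇒Pointwise-≡)
open import Data.List.Relation.Binary.Prefix.Heterogeneous.Properties using (prefix?)
open import Data.List.Relation.Unary.All as All using (All; []; _∷_)
open import Data.Nat using (ℕ; _≤_; _<_; z≤n; s≤s)
import Data.Nat as ℕ
import Data.Nat.Properties as ℕ
open import Data.Product using (Σ; _×_; _,_; proj₁; proj₂; ∃; ∃₂)
open import Data.Sum using (_⊎_; inj₁; inj₂)
open import Data.Vec using (Vec; lookup; tabulate; zipWith)
open import Data.Vec.Properties using (lookup∘tabulate; lookup-zipWith)
open import Function using (_∘_)
open import Relation.Binary.PropositionalEquality
open import Relation.Nullary using (Dec; does; yes; no; ¬_; contradiction)
open import Relation.Nullary.Decidable using (_→-dec_; ¬?; from-yes)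
open import Tactic.MonoidSolver using (solve)
open import Defs

private
  variable
    A : Set
    n : ℕ

-- Comparing two splittings of a list

-- Levi's lemma. A tie, where both left parts agree, falls under the first case; the choices made by
-- `cutʳ` and `cutˡ` at block boundaries rest on this.
++-compare : (xs {ys} us {vs} : List A) → xs ++ ys ≡ us ++ vs →
             (∃ λ zs → us ≡ xs ++ zs × ys ≡ zs ++ vs) ⊎
             (∃ λ zs → xs ≡ us ++ zs × zs ≢ [] × vs ≡ zs ++ ys)
++-compare []       us       eq = inj₁ (us , refl , eq)
++-compare (x ∷ xs) []       eq = inj₂ (x ∷ xs , refl , (λ ()) , sym eq)
++-compare (x ∷ xs) (u ∷ us) eq with refl , eq′ ← ∷-injective eq with ++-compare xs us eq′
... | inj₁ (zs , p , q)     = inj₁ (zs , cong (x ∷_) p , q)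
... | inj₂ (zs , p , r , q) = inj₂ (zs , cong (x ∷_) p , r , q)

take-length-++ : (xs {ys} : List A) → take (length xs) (xs ++ ys) ≡ xs
take-length-++ []       = refl
take-length-++ (x ∷ xs) = cong (x ∷_) (take-length-++ xs)

drop-length-++ : (xs {ys} : List A) → drop (length xs) (xs ++ ys) ≡ ys
drop-length-++ []       = refl
drop-length-++ (x ∷ xs) = drop-length-++ xs

∷-cut : ∀ i (x : A) xs → x ∷ xs ≡ take i (x ∷ []) ++ drop i (x ∷ []) ++ xs
∷-cut i x xs = trans (cong (_++ xs) (sym (take++drop≡id i (x ∷ [])))) (++-assoc (take i (x ∷ [])) _ xs)

-- Counting factors

prefix?-++ : (w u v : Word n) → length w ≤ length u →
             does (prefix? _≟_ w (u ++ v)) ≡ does (prefix? _≟_ w u)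
prefix?-++ []      u       v _         = refl
prefix?-++ (x ∷ w) (y ∷ u) v (s≤s w≤u) = cong (does (x ≟ y) ∧_) (prefix?-++ w u v w≤u)

occurrences-∷ : (w : Word n) (x : Fin n) (u : Word n) →
                occurrences w (x ∷ u) ≡
                (if does (prefix? _≟_ w (x ∷ u)) then 1 else 0) ℕ.+ occurrences w u
occurrences-∷ w x u with does (prefix? _≟_ w (x ∷ u))
... | true  = refl
... | false = refl

-- Inclusion-exclusion: an occurrence reaching from `u` into `v` would have at least two letters
-- more than `m`, so every occurrence lies in `u ++ m` or in `m ++ v`, and those lying in both are
-- the ones in `m`.
occurrences-overlap : (w u m v : Word n) → length w ≤ ℕ.suc (length m) →
                      occurrences w (u ++ m ++ v) ℕ.+ occurrences w m ≡
                      occurrences w (u ++ m) ℕ.+ occurrences w (m ++ v)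
occurrences-overlap w []      m v _   = ℕ.+-comm (occurrences w (m ++ v)) _
occurrences-overlap w (x ∷ u) m v w≤m = begin
  occurrences w (x ∷ u ++ m ++ v) ℕ.+ occurrences w m
    ≡⟨ cong (ℕ._+ _) (occurrences-∷ w x (u ++ m ++ v)) ⟩
  (δ (x ∷ u ++ m ++ v) ℕ.+ occurrences w (u ++ m ++ v)) ℕ.+ occurrences w m
    ≡⟨ ℕ.+-assoc (δ (x ∷ u ++ m ++ v)) _ _ ⟩
  δ (x ∷ u ++ m ++ v) ℕ.+ (occurrences w (u ++ m ++ v) ℕ.+ occurrences w m)
    ≡⟨ cong₂ ℕ._+_ same (occurrences-overlap w u m v w≤m) ⟩
  δ (x ∷ u ++ m) ℕ.+ (occurrences w (u ++ m) ℕ.+ occurrences w (m ++ v))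
    ≡⟨ ℕ.+-assoc (δ (x ∷ u ++ m)) _ _ ⟨
  (δ (x ∷ u ++ m) ℕ.+ occurrences w (u ++ m)) ℕ.+ occurrences w (m ++ v)
    ≡⟨ cong (ℕ._+ _) (occurrences-∷ w x (u ++ m)) ⟨
  occurrences w (x ∷ u ++ m) ℕ.+ occurrences w (m ++ v) ∎
  where
  open ≡-Reasoning
  δ : Word _ → ℕ
  δ y = if does (prefix? _≟_ w y) then 1 else 0
  same : δ (x ∷ u ++ m ++ v) ≡ δ (x ∷ u ++ m)
  same = cong (if_then 1 else 0) (trans
    (cong (λ y → does (prefix? _≟_ w (x ∷ y))) (sym (++-assoc u m v)))
    -- The letter `x` makes up for the `ℕ.suc` in the bound on the length of `w`.
    (prefix?-++ w (x ∷ u ++ m) v (ℕ.≤-trans w≤m (s≤s (length-++-≤ʳ m {u})))))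

count : Fin n → Word n → ℤ
count e u = + occurrences (e ∷ []) u

count-++ : (e : Fin n) (u v : Word n) → count e (u ++ v) ≡ count e u + count e v
count-++ e u v = cong +_ (begin
  occurrences (e ∷ []) (u ++ v)
    -- The summand 0 is the count in the empty overlap.
    ≡⟨ ℕ.+-identityʳ _ ⟨
  occurrences (e ∷ []) (u ++ v) ℕ.+ 0
    ≡⟨ occurrences-overlap (e ∷ []) u [] v (s≤s z≤n) ⟩
  occurrences (e ∷ []) (u ++ []) ℕ.+ occurrences (e ∷ []) v
    ≡⟨ cong (λ y → occurrences (e ∷ []) y ℕ.+ _) (++-identityʳ u) ⟩
  occurrences (e ∷ []) u ℕ.+ occurrences (e ∷ []) v ∎)
  where open ≡-Reasoning

count-≡⇒equivalent : {u v : Word n} → (∀ e → count e u ≡ count e v) → AbelianEquivalent 1 u v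
count-≡⇒equivalent same []          w≢[] _        = contradiction refl w≢[]
count-≡⇒equivalent same (e ∷ [])    _    _        = ℤ.+-injective (same e)
count-≡⇒equivalent same (_ ∷ _ ∷ _) _    (s≤s ())

length-binary : (u : Word 2) →
                length u ≡ occurrences (0F ∷ []) u ℕ.+ occurrences (1F ∷ []) u
length-binary []       = refl
length-binary (0F ∷ u) = cong ℕ.suc (length-binary u)
length-binary (1F ∷ u) = trans (cong ℕ.suc (length-binary u)) (sym (ℕ.+-suc _ _))

-- Over two letters the counts of the one-letter words add up to the length. Hence both halves of a
-- square are as long as its period.
equivalent⇒length : {u v : Word 2} → AbelianEquivalent 3 u v → length u ≡ length v
equivalent⇒length {u} {v} u~v = begin
  length u                                                  ≡⟨ length-binary u ⟩
  occurrences (0F ∷ []) u ℕ.+ occurrences (1F ∷ []) u       ≡⟨ cong₂ ℕ._+_ (same 0F) (same 1F) ⟩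
  occurrences (0F ∷ []) v ℕ.+ occurrences (1F ∷ []) v       ≡⟨ length-binary v ⟨
  length v                                                  ∎
  where
  open ≡-Reasoning
  same : ∀ e → occurrences (e ∷ []) u ≡ occurrences (e ∷ []) v
  same e = u~v (e ∷ []) (λ ()) (s≤s z≤n)

IsTriple : Word n → Set
IsTriple v = length v ≡ 3

equivalent-triple : {u u′ v : Word n} → AbelianEquivalent 3 u u′ → IsTriple v →
                    occurrences v u ≡ occurrences v u′
equivalent-triple {v = v@(_ ∷ _)} u~u′ v≡3 = u~u′ v (λ ()) (ℕ.≤-reflexive v≡3)

squareFree⇒inequivalent : {w : Word n} → AbelianSquareFree w → ∀ p u v q →
                          w ≡ p ++ (u ++ v) ++ q → u ++ v ≢ [] → ¬ AbelianEquivalent 1 u v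
squareFree⇒inequivalent free p u v q refl nonEmpty u~v =
  free (u ++ v) (fromView (MkView p (≡⇒Pointwise-≡ refl) q))
    record { splits = refl ; nonEmpty = nonEmpty ; equivalent = u~v }

-- Linear functionals of the counts of the factors of length 3

Weights : Set
Weights = List (ℤ × Word 2)

score : Weights → Word 2 → ℤ
score []            u = 0ℤ
score ((k , v) ∷ f) u = k * + occurrences v u + score f u

OnTriples : Weights → Set
OnTriples = All (IsTriple ∘ proj₂)

score-equivalent : ∀ {f u v} → OnTriples f → AbelianEquivalent 3 u v → score f u ≡ score f v
score-equivalent             []      u~v = refl
score-equivalent {(k , w) ∷ f} (p ∷ ps) u~v =
  cong₂ (λ i j → k * + i + j) (equivalent-triple {v = w} u~v p) (score-equivalent ps u~v)

-- An overlap of two letters is just enough for factors of length 3.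
score-overlap : ∀ {f} → OnTriples f → ∀ u x y v →
                score f (u ++ x ∷ y ∷ v) + score f (x ∷ y ∷ []) ≡
                score f (u ++ x ∷ y ∷ []) + score f (x ∷ y ∷ v)
score-overlap []                           u x y v = refl
score-overlap {(k , w) ∷ f} (p ∷ ps) u x y v =
  trans (regroup k _ _ _ _)
    (trans (cong₂ (λ i j → k * i + j)
             (cong +_ (occurrences-overlap w u (x ∷ y ∷ []) v (ℕ.≤-reflexive p)))
             (score-overlap ps u x y v))
      (sym (regroup k _ _ _ _)))
  where
  regroup : ∀ k a s b t → (k * a + s) + (k * b + t) ≡ k * (a + b) + (s + t)
  regroup = solve-∀

-- Functionals on images under `h`

h* : Word 4 → Word 2
h* = concatMap hLetter

block-length : ∀ a → length (hLetter a) ≡ 11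
block-length 0F = refl
block-length 1F = refl
block-length 2F = refl
block-length 3F = refl

block-end : ∀ a → hLetter a ≡ take 9 (hLetter a) ++ 1F ∷ 0F ∷ []
block-end 0F = refl
block-end 1F = refl
block-end 2F = refl
block-end 3F = refl

-- Every image of a letter is followed by 0 and preceded by 10 inside h(w); putting 10 in front of
-- it accounts for the factors that straddle the boundary to its left.
record Counts (m : ℤ) (e : Fin 4) (f : Weights) : Set where
  field
    onTriples : OnTriples f
    boundary  : score f (1F ∷ 0F ∷ []) ≡ 0ℤ
    blocks    : ∀ a → score f (1F ∷ 0F ∷ hLetter a) ≡ m * count e (a ∷ [])

module _ {m e f} (counts : Counts m e f) where
  open Counts counts
  open ≡-Reasoning

  -- Each image ends in the same 10 that stands in front of it, so splitting off one image with 10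
  -- as overlap leaves a word of the same shape. By `boundary` the overlap itself scores 0.
  score-h* : ∀ x s → score f (1F ∷ 0F ∷ h* x ++ s) ≡ m * count e x + score f (1F ∷ 0F ∷ s)
  score-h* []      s = sym (trans (cong (_+ _) (ℤ.*-zeroʳ m)) (ℤ.+-identityˡ _))
  score-h* (a ∷ x) s = begin
    score f (1F ∷ 0F ∷ (hLetter a ++ h* x) ++ s)
      ≡⟨ cong (λ y → score f (1F ∷ 0F ∷ y)) split ⟩
    score f (front ++ 1F ∷ 0F ∷ h* x ++ s)
      ≡⟨ ℤ.+-identityʳ _ ⟨
    score f (front ++ 1F ∷ 0F ∷ h* x ++ s) + 0ℤ
      ≡⟨ cong (λ i → score f (front ++ 1F ∷ 0F ∷ h* x ++ s) + i) boundary ⟨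
    score f (front ++ 1F ∷ 0F ∷ h* x ++ s) + score f (1F ∷ 0F ∷ [])
      ≡⟨ score-overlap onTriples front 1F 0F (h* x ++ s) ⟩
    score f (front ++ 1F ∷ 0F ∷ []) + score f (1F ∷ 0F ∷ h* x ++ s)
      ≡⟨ cong₂ _+_ (trans (cong (λ y → score f (1F ∷ 0F ∷ y)) (sym (block-end a))) (blocks a))
                   (score-h* x s) ⟩
    m * count e (a ∷ []) + (m * count e x + score f (1F ∷ 0F ∷ s))
      ≡⟨ factor m _ _ _ ⟩
    m * (count e (a ∷ []) + count e x) + score f (1F ∷ 0F ∷ s)
      ≡⟨ cong (λ i → m * i + score f (1F ∷ 0F ∷ s)) (count-++ e (a ∷ []) x) ⟨
    m * count e (a ∷ x) + score f (1F ∷ 0F ∷ s) ∎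
    where
    front : Word 2
    front = 1F ∷ 0F ∷ take 9 (hLetter a)
    split : (hLetter a ++ h* x) ++ s ≡ take 9 (hLetter a) ++ 1F ∷ 0F ∷ h* x ++ s
    split = begin
      (hLetter a ++ h* x) ++ s                             ≡⟨ ++-assoc (hLetter a) _ s ⟩
      hLetter a ++ h* x ++ s                               ≡⟨ cong (_++ _) (block-end a) ⟩
      (take 9 (hLetter a) ++ 1F ∷ 0F ∷ []) ++ h* x ++ s    ≡⟨ ++-assoc (take 9 (hLetter a)) _ _ ⟩
      take 9 (hLetter a) ++ 1F ∷ 0F ∷ h* x ++ s            ∎
    factor : ∀ m a b c → m * a + (m * b + c) ≡ m * (a + b) + c
    factor = solve-∀

  -- The suffix `t` may be the single letter 0, so 10 need not be available as overlap. The 00 at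
  -- the junction is: splitting there once behind `t` and once behind 10 exchanges the two contexts
  -- at the price of the constant score of 100.
  score-factor : ∀ {t t′ r} x s → t ≡ t′ ∷ʳ 0F → h* x ++ s ≡ 0F ∷ r →
                 score f (t ++ h* x ++ s) + score f (1F ∷ 0F ∷ 0F ∷ []) ≡
                 score f (t ∷ʳ 0F) + (m * count e x + score f (1F ∷ 0F ∷ s))
  score-factor {t} {t′} {r} x s refl starts = begin
    score f (t ++ h* x ++ s) + score f (1F ∷ 0F ∷ 0F ∷ [])
      ≡⟨ cong (λ y → score f (t ++ y) + _) starts ⟩
    score f (t ++ 0F ∷ r) + score f (1F ∷ 0F ∷ 0F ∷ [])
      ≡⟨ cong (λ y → score f y + _) (∷ʳ-++ t′ 0F (0F ∷ r)) ⟩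
    score f (t′ ++ 0F ∷ 0F ∷ r) + score f (1F ∷ 0F ∷ 0F ∷ [])
      ≡⟨ cross (score f (t′ ++ 0F ∷ 0F ∷ r)) (score f (t′ ++ 0F ∷ 0F ∷ [])) (score f (0F ∷ 0F ∷ r))
               (score f (1F ∷ 0F ∷ 0F ∷ r)) (score f (1F ∷ 0F ∷ 0F ∷ [])) (score f (0F ∷ 0F ∷ []))
               (score-overlap onTriples t′ 0F 0F r) (score-overlap onTriples (1F ∷ []) 0F 0F r) ⟩
    score f (t′ ++ 0F ∷ 0F ∷ []) + score f (1F ∷ 0F ∷ 0F ∷ r)
      ≡⟨ cong₂ (λ y z → score f y + score f (1F ∷ 0F ∷ z)) (∷ʳ-++ t′ 0F (0F ∷ [])) starts ⟨
    score f (t ∷ʳ 0F) + score f (1F ∷ 0F ∷ h* x ++ s)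
      ≡⟨ cong (λ i → score f (t ∷ʳ 0F) + i) (score-h* x s) ⟩
    score f (t ∷ʳ 0F) + (m * count e x + score f (1F ∷ 0F ∷ s)) ∎
    where
    swap : ∀ a b c d → (a + b) + (c + d) ≡ (a + c) + (b + d)
    swap = solve-∀
    swap′ : ∀ a b c d → (a + b) + (c + d) ≡ (a + c) + (d + b)
    swap′ = solve-∀
    -- Adding `z + c` to both sides lets the two overlap identities be substituted; it is cancelled
    -- afterwards.
    cross : ∀ a b c d p z → a + z ≡ b + c → d + z ≡ p + c → a + p ≡ b + d
    cross a b c d p z eq₁ eq₂ = group-cancelʳ ℤ.+-0-abelianGroup (z + c) (a + p) (b + d) (begin
      (a + p) + (z + c)  ≡⟨ swap a p z c ⟩
      (a + z) + (p + c)  ≡⟨ cong₂ _+_ eq₁ (sym eq₂) ⟩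
      (b + c) + (d + z)  ≡⟨ swap′ b c d z ⟩
      (b + d) + (z + c)  ∎)

  -- The score of 100 from `score-factor` is the same for both halves and drops out.
  balance : ∀ {t t₀ t′ t₀′ x s r y s′ r′} →
            t ≡ t₀ ∷ʳ 0F → t′ ≡ t₀′ ∷ʳ 0F → h* x ++ s ≡ 0F ∷ r → h* y ++ s′ ≡ 0F ∷ r′ →
            AbelianEquivalent 3 (t ++ h* x ++ s) (t′ ++ h* y ++ s′) →
            score f (t ∷ʳ 0F) + (m * count e x + score f (1F ∷ 0F ∷ s)) ≡
            score f (t′ ∷ʳ 0F) + (m * count e y + score f (1F ∷ 0F ∷ s′))
  balance {x = x} {s} {y = y} {s′} t-end t′-end r-start r′-start equiv =
    trans (sym (score-factor x s t-end r-start))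
      (trans (cong (_+ _) (score-equivalent onTriples equiv))
        (score-factor y s′ t′-end r′-start))

-- The functionals chosen for `h`

weigh : ℤ → ℤ → ℤ → ℤ → Weights
weigh i j k l =
  (i , 0F ∷ 0F ∷ 1F ∷ []) ∷ (j , 0F ∷ 1F ∷ 1F ∷ []) ∷
  (k , 1F ∷ 0F ∷ 1F ∷ []) ∷ (l , 1F ∷ 1F ∷ 1F ∷ []) ∷ []

-- Up to the factor 9, the inverse of the matrix that counts 001, 011, 101 and 111 in the images
-- of the four letters.
dual : Fin 4 → Weights
dual 0F = weigh (- + 2) (- + 1) (+ 6)   (- + 1)
dual 1F = weigh (- + 3) (+ 3)   (+ 0)   (+ 3)
dual 2F = weigh (- + 2) (+ 8)   (- + 3) (- + 1)
dual 3F = weigh (+ 9)   (- + 9) (+ 0)   (+ 0)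

dual-counts : ∀ e → Counts (+ 9) e (dual e)
dual-counts e = record
  { onTriples = from-yes (all? λ e → All.all? (λ (_ , v) → length v ℕ.≟ 3) (dual e)) e
  ; boundary  = from-yes (all? λ e → score (dual e) (1F ∷ 0F ∷ []) ℤ.≟ 0ℤ) e
  ; blocks    = from-yes (all? λ e → all? λ a →
                  score (dual e) (1F ∷ 0F ∷ hLetter a) ℤ.≟ + 9 * count e (a ∷ [])) e
  }

-- A functional vanishing on the four images. It is chosen, among all of them, so that it alone
-- makes the finite check below succeed.
invariant : Weights
invariant =
  (+ 9    , 0F ∷ 0F ∷ 0F ∷ []) ∷ (+ 2   , 0F ∷ 1F ∷ 0F ∷ []) ∷ (+ 3 , 1F ∷ 0F ∷ 0F ∷ []) ∷
  (- + 17 , 1F ∷ 0F ∷ 1F ∷ []) ∷ (- + 2 , 1F ∷ 1F ∷ 1F ∷ []) ∷ []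

-- With factor 0, `Counts` says that all images score 0, so the lemmas made for `dual` serve the
-- invariant too.
invariant-counts : ∀ {e} → Counts 0ℤ e invariant
invariant-counts = record
  { onTriples = refl ∷ refl ∷ refl ∷ refl ∷ refl ∷ []
  ; boundary  = refl
  ; blocks    = from-yes (all? λ a → score invariant (1F ∷ 0F ∷ hLetter a) ℤ.≟ 0ℤ)
  }

-- Cutting h(w)

record Cut (w : Word 4) (u v : Word 2) : Set where
  field
    prior later  : Word 4
    letter       : Fin 4
    before after : Word 2
    word  : w ≡ prior ++ letter ∷ later
    block : hLetter letter ≡ before ++ after
    left  : u ≡ h* prior ++ before
    right : v ≡ after ++ h* later

open Cut

infixr 5 _∷ᶜ_
_∷ᶜ_ : ∀ {w u v} a → Cut w u v → Cut (a ∷ w) (hLetter a ++ u) v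
a ∷ᶜ c = record
  { prior  = a ∷ prior c
  ; later  = later c
  ; letter = letter c
  ; before = before c
  ; after  = after c
  ; word   = cong (a ∷_) (word c)
  ; block  = block c
  ; left   = trans (cong (hLetter a ++_) (left c)) (sym (++-assoc (hLetter a) _ _))
  ; right  = right c
  }

cut-here : ∀ {a w u v z} → hLetter a ≡ u ++ z → v ≡ z ++ h* w → Cut (a ∷ w) u v
cut-here block right = record
  { prior = [] ; word = refl ; block = block ; left = refl ; right = right }

-- A cut between two images is assigned to the letter on its right, whose whole image is then
-- `after`. Such a letter exists because `v` is non-empty.
cutʳ : ∀ w u v → h* w ≡ u ++ v → v ≢ [] → Σ (Cut w u v) λ c → after c ≢ []
cutʳ []      u v eq v≢[] = contradiction (++-conicalʳ u v (sym eq)) v≢[]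
cutʳ (a ∷ w) u v eq v≢[] with ++-compare (hLetter a) u eq
... | inj₁ (z , refl , eq′) with c , c≢[] ← cutʳ w z v eq′ v≢[] = a ∷ᶜ c , c≢[]
... | inj₂ (z , block , z≢[] , right) = cut-here block right , z≢[]

-- The opposite convention, for the end of the square: behind it `h* w` may already be exhausted,
-- but a letter on the left always exists.
cutˡ : ∀ w u v → h* w ≡ u ++ v → u ≢ [] → Σ (Cut w u v) λ c → before c ≢ []
cutˡ []      u v eq u≢[] = contradiction (++-conicalˡ u v (sym eq)) u≢[]
cutˡ (a ∷ w) u v eq u≢[] with ++-compare u (hLetter a) (sym eq)
... | inj₁ (z , block , right) = cut-here block right , u≢[]
... | inj₂ (z , refl , z≢[] , eq′) with c , c≢[] ← cutˡ w z v eq′ z≢[] = a ∷ᶜ c , c≢[]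

block-head : ∀ a → ∃ λ r → hLetter a ≡ 0F ∷ r
block-head 0F = _ , refl
block-head 1F = _ , refl
block-head 2F = _ , refl
block-head 3F = _ , refl

h*-head : ∀ w {u v} → h* w ≡ u ++ v → u ≢ [] → ∃ λ r → u ≡ 0F ∷ r
h*-head w       {[]}    eq u≢[] = contradiction refl u≢[]
h*-head (a ∷ w) {x ∷ u} eq _    with r , p ← block-head a =
  u , cong (_∷ u) (sym (∷-injectiveˡ (trans (cong (_++ h* w) (sym p)) eq)))

block-last : ∀ a {s t} → hLetter a ≡ s ++ t → t ≢ [] → ∃ λ t′ → t ≡ t′ ∷ʳ 0F
block-last a {s} {t} eq t≢[] with initLast t
... | []        = contradiction refl t≢[]
... | t′ ∷ʳ′ x = t′ , cong (t′ ∷ʳ_) (∷ʳ-injectiveʳ (s ++ t′) (take 9 (hLetter a) ∷ʳ 1F)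
  (trans (++-assoc s t′ _) (trans (sym eq) (trans (block-end a) (sym (++-assoc (take 9 (hLetter a)) _ _))))))

-- Long periods

Profile : Set
Profile = ℤ × Vec ℤ 4

profile : Word 2 → Profile
profile u = score invariant u , tabulate λ e → score (dual e) u

_⊝_ : Profile → Profile → Profile
(i , u) ⊝ (j , v) = i - j , zipWith _-_ u v

-- The added letters give the words `t ∷ʳ 0F` and `1F ∷ 0F ∷ s` scored in `balance`.
suffixProfile prefixProfile : Fin 4 → ℕ → Profile
suffixProfile a i = profile (drop i (hLetter a) ∷ʳ 0F)
prefixProfile a i = profile (1F ∷ 0F ∷ take i (hLetter a))

-- The cut inside a moves to the left of a if i = 0 and to its right if i = 1; likewise for b and c.
Shiftable : (a b c : Fin 4) → (Fin 4 → ℤ) → Set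
Shiftable a b c d = ∃ λ (i : Fin 2) → ∃ λ (j : Fin 2) → ∃ λ (k : Fin 2) → ∀ e →
  d e ≡ + 9 * ((count e (drop (toℕ j) (b ∷ [])) + count e (take (toℕ k) (c ∷ []))) -
               (count e (drop (toℕ i) (a ∷ [])) + count e (take (toℕ j) (b ∷ []))))

-- The premises are what the cuts of an actual square satisfy: the invariant balances, and the
-- remaining differences are 9 times the difference of the Parikh vectors of the words `x` and `y`
-- between the cut letters.
Compatible : (a b : Fin 4) → Profile → Fin 4 × Profile → Set
Compatible a b (i , u) (c , j , v) =
  i ≡ j → (∀ e → + 9 ∣ lookup v e - lookup u e) → Shiftable a b c λ e → lookup v e - lookup u e

compatible? : ∀ a b p q → Dec (Compatible a b p q)
compatible? a b (i , u) (c , j , v) =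
  -- The invariant is compared first, so the search for shifts runs only where it balances.
  (i ℤ.≟ j) →-dec (all? λ e → _ ∣? _) →-dec
  (any? λ i → any? λ j → any? λ k → all? λ e → _ ℤ.≟ _)

AllCompatible : (ps qs rs : List (Fin 4 × Profile)) → Set
AllCompatible ps qs rs = All (λ (a , p) → All (λ (b , q) → All (Compatible a b (p ⊝ q)) rs) qs) ps

-- The tables are arguments here so that the evaluator computes each of their entries only once.
allCompatible? : ∀ ps qs rs → Dec (AllCompatible ps qs rs)
allCompatible? ps qs rs =
  All.all? (λ (a , p) → All.all? (λ (b , q) → All.all? (compatible? a b (p ⊝ q)) rs) qs) ps

table : (Fin 4 → ℕ → Profile) → List (Fin 4 × Profile)
table f = cartesianProductWith (λ a i → a , f a i) (allFin 4) (upTo 11)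

-- The middle cut both ends the first half and starts the second. The first two cuts have a
-- non-empty `after`, hence 0 to 10 letters before them; the last has a non-empty `before` of 1 to
-- 11 letters, hence the `ℕ.suc`.
middleProfile endProfile : Fin 4 → ℕ → Profile
middleProfile b j = suffixProfile b j ⊝ prefixProfile b j
endProfile c k = prefixProfile c (ℕ.suc k)

allCompatible : AllCompatible (table suffixProfile) (table middleProfile) (table endProfile)
allCompatible = from-yes (allCompatible? (table suffixProfile) (table middleProfile) (table endProfile))

compatible : ∀ a b c {i j k} → i < 11 → j < 11 → k < 11 →
             Compatible a b (suffixProfile a i ⊝ middleProfile b j) (c , endProfile c k)
compatible a b c i< j< k< =
  All.lookup (All.lookup (All.lookup allCompatible (entry suffixProfile a i<))
                                                   (entry middleProfile b j<))
                                                   (entry endProfile c k<)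
  where
  entry : ∀ f a {i} → i < 11 → (a , f a i) ∈ table f
  entry f a i< = ∈-cartesianProductWith⁺ (λ a i → a , f a i) (∈-allFin a) (∈-upTo⁺ i<)

prefix-take : ∀ {xs s t : List A} → xs ≡ s ++ t → s ≡ take (length s) xs
prefix-take {s = s} refl = sym (take-length-++ s)

suffix-drop : ∀ {xs s t : List A} → xs ≡ s ++ t → t ≡ drop (length s) xs
suffix-drop {s = s} refl = sym (drop-length-++ s)

before-length : ∀ a {s t} → hLetter a ≡ s ++ t → t ≢ [] → length s < 11
before-length a {s} {[]}    _     t≢[] = contradiction refl t≢[]
before-length a {s} {x ∷ t} block _    = subst (length s <_)
  (trans (sym (length-++ s)) (trans (cong length (sym block)) (block-length a)))
  (ℕ.m<m+n (length s) (s≤s z≤n))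

before-take : ∀ a s {t} → hLetter a ≡ s ++ t → s ≢ [] →
              ∃ λ k → k < 11 × s ≡ take (ℕ.suc k) (hLetter a)
before-take a []      _     s≢[] = contradiction refl s≢[]
before-take a (x ∷ s) block _    = length s ,
  subst (length s <_) (trans (cong length (sym block)) (block-length a)) (s≤s (length-++-≤ˡ s)) ,
  prefix-take block

-- A suffix of an image has at most 11 letters, so `u` properly extends beyond it.
overrun : ∀ a {s} t {z} u {v} → hLetter a ≡ s ++ t → 12 ≤ length u → u ++ v ≡ t ++ z →
          ∃ λ r → u ≡ t ++ r × r ≢ [] × z ≡ r ++ v
overrun a {s} t {z} u block 12≤u eq with ++-compare u t eq
... | inj₂ (r , p , r≢[] , q) = r , p , r≢[] , q
... | inj₁ (r , refl , _)     = contradiction (begin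
  12                ≤⟨ 12≤u ⟩
  length u          ≤⟨ length-++-≤ˡ u ⟩
  length (u ++ r)   ≤⟨ length-++-≤ʳ (u ++ r) {s} ⟩
  length (s ++ u ++ r) ≡⟨ cong length block ⟨
  length (hLetter a)   ≡⟨ block-length a ⟩
  11 ∎) ℕ.1+n≰n
  where open ℕ.≤-Reasoning

-- Solves `balance` for the letter counts: the left side depends on the cuts alone.
isolate : ∀ m α x γ β y δ → α + (m * x + γ) ≡ β + (m * y + δ) →
          δ - (α - (β - γ)) ≡ (x - y) * m
isolate m α x γ β y δ eq = begin
  δ - (α - (β - γ))                                            ≡⟨ rearrange m α x γ β y δ ⟩
  ((β + (m * y + δ)) - (α + (m * x + γ))) + (x - y) * m        ≡⟨ cong (_+ (x - y) * m) (ℤ.i≡j⇒i-j≡0 (sym eq)) ⟩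
  0ℤ + (x - y) * m                                             ≡⟨ ℤ.+-identityˡ _ ⟩
  (x - y) * m                                                  ∎
  where
  open ≡-Reasoning
  rearrange : ∀ m α x γ β y δ → δ - (α - (β - γ)) ≡
              ((β + (m * y + δ)) - (α + (m * x + γ))) + (x - y) * m
  rearrange = solve-∀

transpose : ∀ a x b b′ y c → x - y ≡ (b′ + c) - (a + b) → a + (x + b) ≡ b′ + (y + c)
transpose a x b b′ y c eq = begin
  a + (x + b)                        ≡⟨ rearrange a x b y ⟩
  (x - y) + ((a + b) + y)            ≡⟨ cong (_+ ((a + b) + y)) eq ⟩
  (b′ + c - (a + b)) + ((a + b) + y) ≡⟨ rearrange′ a b b′ y c ⟩
  b′ + (y + c)                       ∎
  where
  open ≡-Reasoning
  rearrange : ∀ a x b y → a + (x + b) ≡ (x - y) + ((a + b) + y)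
  rearrange = solve-∀
  rearrange′ : ∀ a b b′ y c → (b′ + c - (a + b)) + ((a + b) + y) ≡ b′ + (y + c)
  rearrange′ = solve-∀

count-++₃ : ∀ (e : Fin n) u v w → count e (u ++ v ++ w) ≡ count e u + (count e v + count e w)
count-++₃ e u v w = trans (count-++ e u (v ++ w)) (cong (λ i → count e u + i) (count-++ e v w))

lookup-profile : ∀ u e → lookup (proj₂ (profile u)) e ≡ score (dual e) u
lookup-profile u = lookup∘tabulate λ e → score (dual e) u

lookup-⊝ : ∀ p q e → lookup (proj₂ (p ⊝ q)) e ≡ lookup (proj₂ p) e - lookup (proj₂ q) e
lookup-⊝ (_ , u) (_ , v) e = lookup-zipWith _-_ e u v

-- The words `x` and `y` are arbitrarily long, but only the difference of their Parikh vectors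
-- matters, and the cuts determine it. The finite check thus yields shifts that compensate for it
-- exactly.
shift : ∀ a b c {i j k} x y {t t′ r r′} → i < 11 → j < 11 → k < 11 →
        drop i (hLetter a) ≡ t ∷ʳ 0F → drop j (hLetter b) ≡ t′ ∷ʳ 0F →
        h* x ++ take j (hLetter b) ≡ 0F ∷ r →
        h* y ++ take (ℕ.suc k) (hLetter c) ≡ 0F ∷ r′ →
        AbelianEquivalent 3 (drop i (hLetter a) ++ h* x ++ take j (hLetter b))
                            (drop j (hLetter b) ++ h* y ++ take (ℕ.suc k) (hLetter c)) →
        ∃ λ i′ → ∃ λ j′ → ∃ λ k′ → ∀ e →
          count e (drop i′ (a ∷ []) ++ x ++ take j′ (b ∷ [])) ≡
          count e (drop j′ (b ∷ []) ++ y ++ take k′ (c ∷ []))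
shift a b c {i} {j} {k} x y i< j< k< end end′ start start′ equiv =
  let i′ , j′ , k′ , eq = compatible a b c i< j< k< invariant≡
                            (λ e → divides (count e x - count e y) (dual≡ e))
      aᵈ = drop (toℕ i′) (a ∷ [])
      bᵗ = take (toℕ j′) (b ∷ [])
      bᵈ = drop (toℕ j′) (b ∷ [])
      cᵗ = take (toℕ k′) (c ∷ [])
  in toℕ i′ , toℕ j′ , toℕ k′ , λ e →
    trans (count-++₃ e aᵈ x bᵗ)
    (trans (transpose (count e aᵈ) (count e x) (count e bᵗ) (count e bᵈ) (count e y) (count e cᵗ)
      (ℤ.*-cancelˡ-≡ (+ 9) _ _ (trans (ℤ.*-comm (+ 9) (count e x - count e y))
                                      (trans (sym (dual≡ e)) (eq e)))))
    (sym (count-++₃ e bᵈ y cᵗ)))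
  where
  t₁ t₂ s₁ s₂ : Word 2
  t₁ = drop i (hLetter a) ∷ʳ 0F
  t₂ = drop j (hLetter b) ∷ʳ 0F
  s₁ = 1F ∷ 0F ∷ take j (hLetter b)
  s₂ = 1F ∷ 0F ∷ take (ℕ.suc k) (hLetter c)
  isolated : ∀ {m e f} → Counts m e f →
             score f s₂ - (score f t₁ - (score f t₂ - score f s₁)) ≡ (count e x - count e y) * m
  isolated {m} {e} {f} counts =
    isolate m (score f t₁) (count e x) (score f s₁) (score f t₂) (count e y) (score f s₂)
      (balance counts {x = x} {y = y} end end′ start start′ equiv)
  invariant≡ : proj₁ (suffixProfile a i ⊝ middleProfile b j) ≡ proj₁ (endProfile c k)
  invariant≡ = sym (ℤ.i-j≡0⇒i≡j _ _
    -- The count of the letter 0 is multiplied by 0; any other letter would do as well.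
    (trans (isolated (invariant-counts {0F})) (ℤ.*-zeroʳ (count 0F x - count 0F y))))
  dual≡ : ∀ e → lookup (proj₂ (endProfile c k)) e -
                lookup (proj₂ (suffixProfile a i ⊝ middleProfile b j)) e ≡
                (count e x - count e y) * + 9
  dual≡ e = trans
    (cong₂ _-_ (lookup-profile s₂ e)
      (trans (lookup-⊝ (suffixProfile a i) (middleProfile b j) e)
        (cong₂ _-_ (lookup-profile t₁ e)
          (trans (lookup-⊝ (suffixProfile b j) (prefixProfile b j) e)
            (cong₂ _-_ (lookup-profile t₂ e) (lookup-profile s₁ e))))))
    (isolated (dual-counts e))

shiftedSquare : ∀ {w} → AbelianSquareFree w → ∀ p a x b y c q i j k →
                w ≡ p ++ a ∷ x ++ b ∷ y ++ c ∷ q →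
                ¬ (∀ e → count e (drop i (a ∷ []) ++ x ++ take j (b ∷ [])) ≡
                         count e (drop j (b ∷ []) ++ y ++ take k (c ∷ [])))
shiftedSquare {w} free p a x b y c q i j k eq same =
  squareFree⇒inequivalent free (p ++ take i (a ∷ [])) (aᵈ ++ x ++ bᵗ) (bᵈ ++ y ++ cᵗ)
    (drop k (c ∷ []) ++ q) (trans eq regroup) nonEmpty (count-≡⇒equivalent same)
  where
  aᵗ = take i (a ∷ [])
  aᵈ = drop i (a ∷ [])
  bᵗ = take j (b ∷ [])
  bᵈ = drop j (b ∷ [])
  cᵗ = take k (c ∷ [])
  cᵈ = drop k (c ∷ [])
  assoc : ∀ (p aᵗ aᵈ x bᵗ bᵈ y cᵗ cᵈ q : Word 4) →
          p ++ aᵗ ++ aᵈ ++ x ++ bᵗ ++ bᵈ ++ y ++ cᵗ ++ cᵈ ++ q ≡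
          (p ++ aᵗ) ++ ((aᵈ ++ x ++ bᵗ) ++ (bᵈ ++ y ++ cᵗ)) ++ cᵈ ++ q
  assoc p aᵗ aᵈ x bᵗ bᵈ y cᵗ cᵈ q = solve (++-monoid (Fin 4))
  regroup : p ++ a ∷ x ++ b ∷ y ++ c ∷ q ≡
            (p ++ aᵗ) ++ ((aᵈ ++ x ++ bᵗ) ++ (bᵈ ++ y ++ cᵗ)) ++ cᵈ ++ q
  regroup = trans
    (cong (p ++_) (trans (∷-cut i a _) (cong (λ z → aᵗ ++ aᵈ ++ z)
      (cong (x ++_) (trans (∷-cut j b _) (cong (λ z → bᵗ ++ bᵈ ++ z)
        (cong (y ++_) (∷-cut k c q))))))))
    (assoc p aᵗ aᵈ x bᵗ bᵈ y cᵗ cᵈ q)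
  -- Wherever the middle cut moves, the letter `b` lands in one of the halves.
  nonEmpty : (aᵈ ++ x ++ bᵗ) ++ bᵈ ++ y ++ cᵗ ≢ []
  nonEmpty empty
    with u≡[] ← ++-conicalˡ (aᵈ ++ x ++ bᵗ) _ empty
       | v≡[] ← ++-conicalʳ (aᵈ ++ x ++ bᵗ) _ empty
    with () ← trans (sym (take++drop≡id j (b ∷ [])))
      (cong₂ _++_ (++-conicalʳ x _ (++-conicalʳ aᵈ _ u≡[])) (++-conicalˡ bᵈ _ v≡[]))

extent : ∀ {w u v s} (c : Cut w u v) → before c ≡ s → u ≡ h* (prior c) ++ s
extent c s≡ = trans (left c) (cong (h* (prior c) ++_) s≡)

-- Each cut is taken in what follows the letter of the previous one, so `w` is p a x b y c q with
-- `x` and `y` the words `prior c₂` and `prior c₃`.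
cutsInequivalent :
  ∀ {w u v z₁ v₁ z₂ v₂ u₁ u₂} → AbelianSquareFree w →
  (c₁ : Cut w u v) (c₂ : Cut (later c₁) z₁ v₁) (c₃ : Cut (later c₂) z₂ v₂) →
  after c₁ ≢ [] → after c₂ ≢ [] → before c₃ ≢ [] →
  h* (later c₁) ≡ z₁ ++ v₁ → h* (later c₂) ≡ z₂ ++ v₂ → z₁ ≢ [] → z₂ ≢ [] →
  u₁ ≡ after c₁ ++ z₁ → u₂ ≡ after c₂ ++ z₂ → ¬ AbelianEquivalent 3 u₁ u₂
cutsInequivalent free c₁ c₂ c₃ t₁≢[] t₂≢[] s₃≢[] eq₁ eq₂ z₁≢[] z₂≢[] u₁≡ u₂≡ u₁~u₂
  with k , k< , s₃≡ ← before-take (letter c₃) (before c₃) (block c₃) s₃≢[] =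
  let z₁≡ = extent c₂ (prefix-take (block c₂))
      z₂≡ = extent c₃ s₃≡
      i′ , j′ , k′ , same = shift (letter c₁) (letter c₂) (letter c₃) (prior c₂) (prior c₃)
        (before-length (letter c₁) (block c₁) t₁≢[]) (before-length (letter c₂) (block c₂) t₂≢[]) k<
        (trans (sym (suffix-drop (block c₁))) (proj₂ (block-last (letter c₁) (block c₁) t₁≢[])))
        (trans (sym (suffix-drop (block c₂))) (proj₂ (block-last (letter c₂) (block c₂) t₂≢[])))
        (trans (sym z₁≡) (proj₂ (h*-head (later c₁) eq₁ z₁≢[])))
        (trans (sym z₂≡) (proj₂ (h*-head (later c₂) eq₂ z₂≢[])))
        (subst₂ (AbelianEquivalent 3) (trans u₁≡ (cong₂ _++_ (suffix-drop (block c₁)) z₁≡))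
                                      (trans u₂≡ (cong₂ _++_ (suffix-drop (block c₂)) z₂≡)) u₁~u₂)
  in shiftedSquare free (prior c₁) (letter c₁) (prior c₂) (letter c₂) (prior c₃) (letter c₃)
       (later c₃) i′ j′ k′
       (trans (word c₁) (cong (λ y → prior c₁ ++ letter c₁ ∷ y)
         (trans (word c₂) (cong (λ y → prior c₂ ++ letter c₂ ∷ y) (word c₃)))))
       same

-- Each half is longer than an image, so the three ends can be placed in the images of three
-- distinct positions of `w`.
noLongSquare : ∀ {w} → AbelianSquareFree w → ∀ u u₁ u₂ v → h* w ≡ u ++ u₁ ++ u₂ ++ v →
               12 ≤ length u₁ → 12 ≤ length u₂ → ¬ AbelianEquivalent 3 u₁ u₂
noLongSquare {w} free u u₁@(_ ∷ _) u₂@(_ ∷ _) v eq 12≤u₁ 12≤u₂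
  with c₁ , t₁≢[] ← cutʳ w u (u₁ ++ u₂ ++ v) eq (λ ())
  with z₁ , u₁≡ , z₁≢[] , eq₁ ← overrun (letter c₁) (after c₁) u₁ (block c₁) 12≤u₁ (right c₁)
  with c₂ , t₂≢[] ← cutʳ (later c₁) z₁ (u₂ ++ v) eq₁ (λ ())
  with z₂ , u₂≡ , z₂≢[] , eq₂ ← overrun (letter c₂) (after c₂) u₂ (block c₂) 12≤u₂ (right c₂)
  with c₃ , s₃≢[] ← cutˡ (later c₂) z₂ v eq₂ z₂≢[]
  = cutsInequivalent free c₁ c₂ c₃ t₁≢[] t₂≢[] s₃≢[] eq₁ eq₂ z₁≢[] z₂≢[] u₁≡ u₂≡

-- Short periods

triples : List (Word 2)
triples = concatMap (λ x → concatMap (λ y → map (λ z → x ∷ y ∷ z ∷ []) (allFin 2)) (allFin 2)) (allFin 2)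

-- A decidable consequence of 3-abelian equivalence that is strong enough for the inspection.
SameTriples : Word 2 → Word 2 → Set
SameTriples u v = All (λ t → occurrences t u ≡ occurrences t v) triples

sameTriples? : ∀ u v → Dec (SameTriples u v)
sameTriples? u v = All.all? (λ t → occurrences t u ℕ.≟ occurrences t v) triples

equivalent⇒sameTriples : ∀ {u v} → AbelianEquivalent 3 u v → SameTriples u v
equivalent⇒sameTriples u~v =
  All.map (λ {t} → equivalent-triple {v = t} u~v) (from-yes (All.all? (λ t → length t ℕ.≟ 3) triples))

SquareIn : Word 2 → ℕ → Set
SquareIn u p = SameTriples (take p u) (take p (drop p u))

-- A square starting after at most 10 letters, of period at most 11, ends within the 33 letters of
-- three images. Period 2 has to be left out, since `hLetter 0F` contains 1010.
noSquareInBlocks : ∀ a b c → a ≢ b → b ≢ c → ∀ {i} → i < 11 → ∀ {k} → k < 9 →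
                   ¬ SquareIn (drop i (hLetter a ++ hLetter b ++ hLetter c)) (3 ℕ.+ k)
noSquareInBlocks = from-yes
  (all? λ a → all? λ b → all? λ c → ¬? (a ≟ b) →-dec ¬? (b ≟ c) →-dec
   ℕ.allUpTo? (λ i → ℕ.allUpTo? (λ k →
     let u = drop i (hLetter a ++ hLetter b ++ hLetter c) in
     ¬? (sameTriples? (take (3 ℕ.+ k) u) (take (3 ℕ.+ k) (drop (3 ℕ.+ k) u)))) 9) 11)

take-drop-square : ∀ {u₁ u₂ z : Word 2} {p} → length u₁ ≡ p → length u₂ ≡ p →
                   AbelianEquivalent 3 u₁ u₂ → SquareIn (u₁ ++ u₂ ++ z) p
take-drop-square {u₁} {u₂} {z} refl eq u₁~u₂ = subst₂ SameTriples
  (sym (take-length-++ u₁))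
  (sym (trans (cong (take (length u₁)) (drop-length-++ u₁))
    (trans (cong (λ p → take p (u₂ ++ z)) (sym eq)) (take-length-++ u₂))))
  (equivalent⇒sameTriples u₁~u₂)

squareFree⇒≢ : ∀ {w : Word n} → AbelianSquareFree w → ∀ p {a b q} → w ≡ p ++ a ∷ b ∷ q → a ≢ b
squareFree⇒≢ free p {a} eq refl =
  squareFree⇒inequivalent free p (a ∷ []) (a ∷ []) _ eq (λ ()) (λ _ _ _ → refl)

another : ∀ a → ∃ λ (b : Fin 4) → a ≢ b
another 0F      = 1F , λ ()
another (suc _) = 0F , λ ()

-- Near the end of `w` fewer than two letters may follow `a`. Padding with letters that differ from
-- their neighbours brings this case under the inspection of three images.
completion : ∀ {w : Word 4} → AbelianSquareFree w → ∀ p a x → w ≡ p ++ a ∷ x →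
             ∃₂ λ b c → a ≢ b × b ≢ c × ∃₂ λ y z → x ++ y ≡ b ∷ c ∷ z
completion free p a [] eq with b , a≢b ← another a =
  b , a , a≢b , (λ b≡a → a≢b (sym b≡a)) , b ∷ a ∷ [] , [] , refl
completion free p a (b ∷ []) eq with c , b≢c ← another b =
  b , c , squareFree⇒≢ free p eq , b≢c , c ∷ [] , [] , refl
completion free p a (b ∷ c ∷ x) eq =
  b , c , squareFree⇒≢ free p eq ,
  squareFree⇒≢ free (p ∷ʳ a) (trans eq (sym (∷ʳ-++ p a (b ∷ c ∷ x)))) , [] , x , ++-identityʳ _

prefix-of-longer : (xs us : List A) {ys vs : List A} → xs ++ ys ≡ us ++ vs → length xs ≤ length us →
                   ∃ λ zs → us ≡ xs ++ zs
prefix-of-longer xs us eq le with ++-compare xs us eq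
... | inj₁ (zs , p , _)             = zs , p
... | inj₂ ([]    , _ , zs≢[] , _)  = contradiction refl zs≢[]
... | inj₂ (z ∷ zs , refl , _ , _)  = contradiction
  (subst (length us <_) (sym (length-++ us)) (ℕ.m<m+n (length us) (s≤s z≤n))) (ℕ.≤⇒≯ le)

squareInBlocks :
  ∀ {w u u₁ u₂ v} (cut : Cut w u (u₁ ++ u₂ ++ v)) b c {y z} → later cut ++ y ≡ b ∷ c ∷ z →
  length (u₁ ++ u₂) ≤ 22 →
  ∃ λ r → drop (length (before cut)) (hLetter (letter cut) ++ hLetter b ++ hLetter c) ≡ u₁ ++ u₂ ++ r
squareInBlocks {w} {u} {u₁} {u₂} {v} cut b c {y} {z} x++y≡ u₁₂≤22 =
  proj₁ prefix , (begin
    drop (length (before cut)) (hLetter (letter cut) ++ rest)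
      ≡⟨ cong (λ x → drop (length (before cut)) (x ++ rest)) (block cut) ⟩
    drop (length (before cut)) ((before cut ++ after cut) ++ rest)
      ≡⟨ cong (drop (length (before cut))) (++-assoc (before cut) (after cut) rest) ⟩
    drop (length (before cut)) (before cut ++ after cut ++ rest)
      ≡⟨ drop-length-++ (before cut) ⟩
    after cut ++ rest
      ≡⟨ proj₂ prefix ⟩
    (u₁ ++ u₂) ++ proj₁ prefix
      ≡⟨ ++-assoc u₁ u₂ _ ⟩
    u₁ ++ u₂ ++ proj₁ prefix ∎)
  where
  open ≡-Reasoning
  rest : Word 2
  rest = hLetter b ++ hLetter c
  completed : (u₁ ++ u₂) ++ v ++ h* y ≡ (after cut ++ rest) ++ h* z
  completed = begin
    (u₁ ++ u₂) ++ v ++ h* y                           ≡⟨ ++-assoc u₁ u₂ _ ⟩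
    u₁ ++ u₂ ++ v ++ h* y                             ≡⟨ cong (u₁ ++_) (++-assoc u₂ v _) ⟨
    u₁ ++ (u₂ ++ v) ++ h* y                           ≡⟨ ++-assoc u₁ (u₂ ++ v) _ ⟨
    (u₁ ++ u₂ ++ v) ++ h* y                           ≡⟨ cong (_++ h* y) (right cut) ⟩
    (after cut ++ h* (later cut)) ++ h* y             ≡⟨ ++-assoc (after cut) _ _ ⟩
    after cut ++ h* (later cut) ++ h* y               ≡⟨ cong (after cut ++_) (concatMap-++ hLetter (later cut) y) ⟨
    after cut ++ h* (later cut ++ y)                  ≡⟨ cong (λ x → after cut ++ h* x) x++y≡ ⟩
    after cut ++ hLetter b ++ hLetter c ++ h* z       ≡⟨ cong (after cut ++_) (++-assoc (hLetter b) _ _) ⟨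
    after cut ++ rest ++ h* z                         ≡⟨ ++-assoc (after cut) rest _ ⟨
    (after cut ++ rest) ++ h* z                       ∎
  rest-length : length rest ≡ 22
  rest-length = trans (length-++ (hLetter b)) (cong₂ ℕ._+_ (block-length b) (block-length c))
  prefix : ∃ λ r → after cut ++ rest ≡ (u₁ ++ u₂) ++ r
  prefix = prefix-of-longer (u₁ ++ u₂) (after cut ++ rest) completed
    -- The two further images alone have 22 letters, so the square fits however short `after cut`
    -- is.
    (ℕ.≤-trans u₁₂≤22 (subst (_≤ length (after cut ++ rest)) rest-length (length-++-≤ʳ rest {after cut})))

noShortSquare : ∀ {w} → AbelianSquareFree w → ∀ u u₁ u₂ v → h* w ≡ u ++ u₁ ++ u₂ ++ v →
                ∀ k → length u₁ ≡ 3 ℕ.+ k → length u₂ ≡ 3 ℕ.+ k → k < 9 →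
                ¬ AbelianEquivalent 3 u₁ u₂
noShortSquare {w} free u u₁@(_ ∷ _) u₂ v eq k u₁≡ u₂≡ k< u₁~u₂
  with cut , t≢[] ← cutʳ w u (u₁ ++ u₂ ++ v) eq (λ ())
  with b , c , a≢b , b≢c , y , z , x++y≡ ←
       completion free (prior cut) (letter cut) (later cut) (word cut)
  with r , inside ← squareInBlocks {u₁ = u₁} {u₂} cut b c x++y≡
       (subst (_≤ 22) (sym (length-++ u₁))
         (ℕ.+-mono-≤ (ℕ.≤-trans (ℕ.≤-reflexive u₁≡) (ℕ.+-monoʳ-≤ 3 (ℕ.≤-pred k<)))
                     (ℕ.≤-trans (ℕ.≤-reflexive u₂≡) (ℕ.+-monoʳ-≤ 3 (ℕ.≤-pred k<)))))
  = noSquareInBlocks (letter cut) b c a≢b b≢c (before-length (letter cut) (block cut) t≢[]) k<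
      (subst (λ x → SquareIn x (3 ℕ.+ k)) (sym inside) (take-drop-square u₁≡ u₂≡ u₁~u₂))

noSquare : ∀ {w} → AbelianSquareFree w → ∀ u u₁ u₂ v → h* w ≡ u ++ (u₁ ++ u₂) ++ v →
           AbelianEquivalent 3 u₁ u₂ → ¬ 3 ≤ length u₁
-- The threshold 12 is one more than the length of an image.
noSquare free u u₁ u₂ v eq u₁~u₂ 3≤u₁ with 12 ℕ.≤? length u₁
... | yes 12≤u₁ = noLongSquare free u u₁ u₂ v (trans eq (cong (u ++_) (++-assoc u₁ u₂ v)))
                    12≤u₁ (subst (12 ≤_) (equivalent⇒length u₁~u₂) 12≤u₁) u₁~u₂
... | no 12≰u₁ with k , 3+k≡ ← ℕ.m≤n⇒∃[o]m+o≡n 3≤u₁ =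
  noShortSquare free u u₁ u₂ v (trans eq (cong (u ++_) (++-assoc u₁ u₂ v))) k (sym 3+k≡)
    (trans (sym (equivalent⇒length u₁~u₂)) (sym 3+k≡))
    (ℕ.+-cancelˡ-< 3 k 9 (subst (_< 12) (sym 3+k≡) (ℕ.≰⇒> 12≰u₁))) u₁~u₂

theorem1 : AbelianSquareFreeMorphism 3 3 h
theorem1 w free x x⊑h*w square = avoided (h* w) refl (toView x⊑h*w)
  where
  open AbelianSquare square
  avoided : ∀ y → h* w ≡ y → View _≡_ x y → ¬ 3 ≤ period
  avoided y eq (MkView u x≡ v) = noSquare free u u₁ u₂ v
    (trans eq (cong (λ z → u ++ z ++ v) (trans (sym (Pointwise-≡⇒≡ x≡)) splits))) equivalent
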